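{- Let $(G,\gamma)$ be an edge-colored graph with $m$ edges and $\ell$ colors $c_1,\dots,c_\ell$, and let $(\delta_1,\delta_2,\ldots,\delta_m)$ be its dip sequence, that is, the dip numbers of all edges of $G$ arranged so that $\delta_1\geq\delta_2\geq\cdots\geq\delta_m$. Then \[\operatorname{wld}(G)\geq\min\left\{p:\delta_1+\delta_2+\cdots+\delta_p\geq\sum_{i=1}^{\ell}(\kappa(G_i)-1)\right\},\] where $p$ ranges over $\{0,1,\dots,m\}$ and the empty sum ($p=0$) is $0$.
   Context: An edge-colored graph $(G,\gamma)$ is a finite connected graph $G$ with a surjective function $\gamma:E(G)\to\mathcal{C}=\{c_1,\dots,c_\ell\}$ onto a finite set of colors (not necessarily a proper edge-coloring). For each color $c_i$ let $E_i(G)=\{e\in E(G):\gamma(e)=c_i\}$ and let $G_i$ be the graph with vertex set $V(G)$ and edge set $E_i(G)$; $\kappa(\cdot)$ denotes the number of connected components. For $W\subseteq E(G)$, let $G_i^W$ be the graph with vertex set $V(G)$ and edge set $W\cup E_i(G)$; write $G_i^{e}$ for $G_i^{\{e\}}$. The set $W$ is color-connecting if $G_i^W$ is connected for every color $c_i\in\mathcal{C}$. The wild number $\operatorname{wld}(G)$ is the minimum size of a color-connecting set. The dip number of an edge $e$ is $\delta(e)=\#\{i:\kappa(G_i^{e})<\kappa(G_i)\}=\sum_{i=1}^{\ell}(\kappa(G_i)-\kappa(G_i^{e}))$. -}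

module Defs where

open import Level using (0ℓ)
open import Data.Bool using (true; false)
open import Data.Empty using (⊥-elim)
open import Data.Nat using (ℕ; zero; suc; _≤_; _∸_; z≤n; s≤s; _<?_)
open import Data.Nat.ListAction using (sum)
import Data.Nat.Properties as ℕ
open import Data.Fin using (Fin; zero; suc; _≟_; punchIn; punchOut)
open import Data.Fin.Properties
  using (all?; ¬Fin0; punchOut-cong; punchOut-injective; punchOut-punchIn; punchInᵢ≢i)
open import Data.Fin.Subset using (Subset; _∈_; ⊤; ⁅_⁆; _∪_; ∣_∣)
open import Data.Fin.Subset.Properties using (∈⊤; ∣⊤∣≡n; p⊆p∪q; anySubset?)
open import Data.List using (List; length; filter; allFin; map; tabulate)
import Data.List.Sort
import Data.Vec as Vec
open Vec using (here; there)
open import Data.Product using (∃; ∃-syntax; _×_; _,_; proj₁; proj₂)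
open import Data.Sum using (_⊎_; inj₁; inj₂)
open import Function using (_∘_)
open import Function.Definitions using (StrictlySurjective)
open import Relation.Binary.Core using (Rel; _⇒_)
import Relation.Binary.Construct.Closure.Equivalence as Eq
open Eq using (EqClosure)
import Relation.Binary.Construct.Flip.EqAndOrd as Flip
import Relation.Binary.Construct.On as On
open import Relation.Binary.PropositionalEquality
open import Relation.Binary.Structures using (IsEquivalence)
open import Relation.Nullary using (yes; no; does)
open import Relation.Nullary.Decidable using (map′; _×-dec_)
open import Relation.Unary using (Pred; Decidable)

------------------------------------------------------------------------
-- Minima of sets of natural numbers

IsMinimum : Pred ℕ 0ℓ → Pred ℕ 0ℓ
IsMinimum P k = P k × (∀ j → P j → k ≤ j)

minimum : {P : Pred ℕ 0ℓ} → Decidable P → ∃ P → ∃ (IsMinimum P)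
minimum {P} P? (k , pk) = go P? k pk
  where
  go : {Q : Pred ℕ 0ℓ} → Decidable Q → ∀ k → Q k → ∃ (IsMinimum Q)
  go Q? k q with Q? zero
  go Q? k       q | yes q₀ = zero , q₀ , λ _ _ → z≤n
  go Q? zero    q | no ¬q₀ = ⊥-elim (¬q₀ q)
  go Q? (suc k) q | no ¬q₀ with go (Q? ∘ suc) k q
  ... | j , qj , least = suc j , qj , λ where
    zero    q₀ → ⊥-elim (¬q₀ q₀)
    (suc i) qi → s≤s (least i qi)

------------------------------------------------------------------------
-- Graphs and their spanning subgraphs

-- Vertices are Fin n and edges are Fin m; loops and parallel edges are
-- allowed. The order of the two ends of an edge carries no meaning, as
-- only the equivalence closure of Adjacent is ever used.
record Graph (n m : ℕ) : Set where
  constructor graph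
  field
    ends : Fin m → Fin n × Fin n

-- A set S of edges stands for the spanning subgraph (V(G) , S).
module _ {n m : ℕ} (G : Graph n m) where
  open Graph G

  Adjacent : Subset m → Rel (Fin n) 0ℓ
  Adjacent S u v = ∃[ e ] e ∈ S × ends e ≡ (u , v)

  Joined : Subset m → Rel (Fin n) 0ℓ
  Joined S = EqClosure (Adjacent S)

  -- The graph without vertices is not connected.
  Connected : Subset m → Set
  Connected S = Fin n × (∀ u v → Joined S u v)

------------------------------------------------------------------------
-- Number of connected components

-- The quotient of Fin n by the equivalence closure of R is Fin k.
record Components {n : ℕ} (R : Rel (Fin n) 0ℓ) (k : ℕ) : Set where
  field
    label      : Fin n → Fin k
    surjective : StrictlySurjective _≡_ label
    sound      : ∀ {u v} → label u ≡ label v → EqClosure R u v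
    complete   : ∀ {u v} → EqClosure R u v → label u ≡ label v

private
  module _ {n : ℕ} {R R′ : Rel (Fin n) 0ℓ} where

    transport : R ⇒ R′ → R′ ⇒ R → ∃ (Components R) → ∃ (Components R′)
    transport f g (k , c) = k , record
      { label      = label
      ; surjective = surjective
      ; sound      = Eq.map f ∘ sound
      ; complete   = complete ∘ Eq.map g
      } where open Components c

    -- R′ is R with one extra related pair (a , b).
    addPair : ∀ a b → R ⇒ R′ → R′ a b →
              (∀ {u v} → R′ u v → R u v ⊎ (u ≡ a × v ≡ b)) →
              ∃ (Components R) → ∃ (Components R′)
    addPair a b f ab g (zero , c) = ⊥-elim (¬Fin0 (Components.label c a))
    addPair a b f ab g (suc k , c) with Components.label c b ≟ Components.label c a
    ... | yes eq = suc k , record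
      { label      = label
      ; surjective = surjective
      ; sound      = Eq.map f ∘ sound
      ; complete   = Eq.fold (On.isEquivalence label isEquivalence)
                             (λ r → step (g r))
      }
      where
      open Components c
      step : ∀ {u v} → R u v ⊎ (u ≡ a × v ≡ b) → label u ≡ label v
      step (inj₁ r)             = complete (Eq.return r)
      step (inj₂ (refl , refl)) = sym eq
    ... | no b≢a = k , record
      { label      = merge ∘ label
      ; surjective = λ y → let (u , eq) = surjective (punchIn (label b) y)
                           in u , trans (cong merge eq) (merge-punchIn y)
      ; sound      = λ {u} {v} → merge-sound u v
      ; complete   = Eq.fold (On.isEquivalence (merge ∘ label) isEquivalence)
                             (λ r → step (g r))
      }
      where
      open Components c

      merge : Fin (suc k) → Fin k
      merge x with label b ≟ x
      ... | yes _  = punchOut b≢a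
      ... | no b≢x = punchOut b≢x

      merge-punchIn : ∀ y → merge (punchIn (label b) y) ≡ y
      merge-punchIn y with label b ≟ punchIn (label b) y
      ... | yes eq = ⊥-elim (punchInᵢ≢i (label b) y (sym eq))
      ... | no  _  = trans (punchOut-cong (label b) refl) (punchOut-punchIn (label b))

      merge-ab : merge (label a) ≡ merge (label b)
      merge-ab with label b ≟ label a | label b ≟ label b
      ... | yes eq | _      = ⊥-elim (b≢a eq)
      ... | no _   | yes _  = punchOut-cong (label b) refl
      ... | no _   | no b≢b = ⊥-elim (b≢b refl)

      lift : ∀ {u v} → label u ≡ label v → EqClosure R′ u v
      lift = Eq.map f ∘ sound

      a~b : EqClosure R′ a b
      a~b = Eq.return ab

      infixr 5 _⨾_
      _⨾_ : ∀ {u v w} → EqClosure R′ u v → EqClosure R′ v w → EqClosure R′ u w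
      _⨾_ = Eq.transitive R′

      merge-sound : ∀ u v → merge (label u) ≡ merge (label v) → EqClosure R′ u v
      merge-sound u v eq with label b ≟ label u | label b ≟ label v
      ... | yes bu | yes bv = lift (trans (sym bu) bv)
      ... | yes bu | no  bv = lift (sym bu) ⨾ Eq.symmetric R′ a~b
                              ⨾ lift (punchOut-injective b≢a bv eq)
      ... | no  bu | yes bv = lift (punchOut-injective bu b≢a eq) ⨾ a~b ⨾ lift bv
      ... | no  bu | no  bv = lift (punchOut-injective bu bv eq)

      step : ∀ {u v} → R u v ⊎ (u ≡ a × v ≡ b) → merge (label u) ≡ merge (label v)
      step (inj₁ r)             = cong merge (complete (Eq.return r))
      step (inj₂ (refl , refl)) = merge-ab

components : ∀ {n m} (G : Graph n m) (S : Subset m) → ∃ (Components (Adjacent G S))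
components {m = zero} G Vec.[] = _ , record
  { label      = λ u → u
  ; surjective = λ u → u , refl
  ; sound      = λ { refl → Eq.reflexive _ }
  ; complete   = Eq.fold isEquivalence λ { (() , _) }
  }
components {m = suc m} G (false Vec.∷ S) =
  transport (λ { (e , e∈S , eq) → suc e , there e∈S , eq })
            (λ { (suc e , there e∈S , eq) → e , e∈S , eq })
            (components (graph (Graph.ends G ∘ suc)) S)
components {m = suc m} G (true Vec.∷ S) =
  addPair (proj₁ (Graph.ends G zero)) (proj₂ (Graph.ends G zero))
          (λ { (e , e∈S , eq) → suc e , there e∈S , eq })
          (zero , here , refl)
          (λ { (zero , _ , refl)          → inj₂ (refl , refl)
             ; (suc e , there e∈S , eq) → inj₁ (e , e∈S , eq) })
          (components (graph (Graph.ends G ∘ suc)) S)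

κ : ∀ {n m} → Graph n m → Subset m → ℕ
κ G S = proj₁ (components G S)

------------------------------------------------------------------------
-- Edge-colored graphs

record EdgeColoredGraph (n m ℓ : ℕ) : Set where
  field
    underlying   : Graph n m
    connected    : Connected underlying ⊤
    γ            : Fin m → Fin ℓ
    γ-surjective : StrictlySurjective _≡_ γ

module _ {n m ℓ : ℕ} (G : EdgeColoredGraph n m ℓ) where
  open EdgeColoredGraph G

  colorClass : Fin ℓ → Subset m
  colorClass i = Vec.tabulate (λ e → does (γ e ≟ i))

  ColorConnecting : Subset m → Set
  ColorConnecting W = ∀ i → Connected underlying (W ∪ colorClass i)

  dip : Fin m → ℕ
  dip e = length (filter (λ i → κ underlying (⁅ e ⁆ ∪ colorClass i)
                                  <? κ underlying (colorClass i))
                         (allFin ℓ))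

  dipSequence : List ℕ
  dipSequence = sort (map dip (allFin m))
    where open Data.List.Sort (Flip.decTotalOrder ℕ.≤-decTotalOrder) using (sort)

  -- No term is truncated: n is positive by connectedness, so κ is positive.
  totalExcess : ℕ
  totalExcess = sum (tabulate (λ i → κ underlying (colorClass i) ∸ 1))

  IsColorConnectingSize : Pred ℕ 0ℓ
  IsColorConnectingSize k = ∃[ W ] ColorConnecting W × ∣ W ∣ ≡ k

  private
    connected? : Decidable (Connected underlying)
    connected? S = map′ (λ j → proj₁ connected , j) proj₂
      (all? λ u → all? λ v → map′ sound complete (label u ≟ label v))
      where open Components (proj₂ (components underlying S))

    ⊤-colorConnecting : ColorConnecting ⊤
    ⊤-colorConnecting i = proj₁ connected , λ u v →
      Eq.map (λ { (e , _ , eq) → e , p⊆p∪q (colorClass i) ∈⊤ , eq })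
             (proj₂ connected u v)

  minColorConnecting : ∃ (IsMinimum IsColorConnectingSize)
  minColorConnecting = minimum
    (λ k → anySubset? λ W →
      all? (λ i → connected? (W ∪ colorClass i)) ×-dec (∣ W ∣ ℕ.≟ k))
    (m , ⊤ , ⊤-colorConnecting , ∣⊤∣≡n m)

  wld : ℕ
  wld = proj₁ minColorConnecting

{-# OPTIONS --safe #-}

-- Adding an edge to a spanning subgraph loses at most one component, and it
-- loses none if it already loses none when added to a smaller subgraph.
-- Hence, for each color i, the edges of a color-connecting set W that lower
-- κ(G_i) on their own number at least κ(G_i) - 1. Summing over i and counting
-- the pairs (edge, color) the other way round, the dip numbers of the edges of W
-- add up to at least the total excess, so the ∣W∣ largest ones do too.
module Submission where

open import Defs
open import Data.Nat using (ℕ; _≤_; _≥_)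
open import Data.Nat.ListAction using (sum)
open import Data.List using (take)
open import Data.Product using (∃-syntax; _×_)

open import Level using (0ℓ)
open import Data.Nat using (zero; suc; _+_; _<_; _∸_; z≤n; s≤s; _<?_; _≤?_)
import Data.Nat.Properties as ℕ
open import Algebra.Properties.CommutativeSemigroup ℕ.+-commutativeSemigroup using (x∙yz≈y∙xz)
open import Data.Fin using (Fin; zero; suc; _≟_)
open import Data.Fin.Properties using (injective⇒≤; suc-injective)
open import Data.Fin.Subset using (Subset; inside; outside; _∈_; _∪_; _⊆_; ⁅_⁆; ∣_∣)
open import Data.Fin.Subset.Properties
  using (_∈?_; ∣p∣≤n; x∈p∪q⁻; x∈p∪q⁺; q⊆p∪q; x∈⁅x⁆; x∈⁅y⁆⇒x≡y; drop-there)
open import Data.List using (List; []; _∷_; length; filter; foldr; map; allFin; tabulate)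
open import Data.List.Properties using (map-tabulate; filter-accept; filter-reject; length-map)
import Data.List.Membership.Propositional as List
open import Data.List.Membership.Propositional.Properties using (∈-allFin; ∈-filter⁺)
open import Data.List.Relation.Binary.Permutation.Propositional using (_↭_; ↭-sym)
open import Data.List.Relation.Binary.Permutation.Propositional.Properties
  using (↭-map-inv; ↭-length; filter-↭; ∈-resp-↭)
open import Data.List.Relation.Binary.Sublist.Propositional as Sublist
  using ([]; _∷_; _∷ʳ_)
open import Data.List.Relation.Binary.Sublist.Propositional.Properties
  using (filter-⊆; map⁺; ∷ˡ⁻)
import Data.List.Relation.Unary.All as All
open import Data.List.Relation.Unary.AllPairs using (AllPairs; _∷_)
open import Data.List.Relation.Unary.Any using (here; there)
open import Data.List.Relation.Unary.Sorted.TotalOrder.Properties using (Sorted⇒AllPairs)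
import Data.List.Sort
import Data.Vec as Vec
open import Data.Product using (_,_; proj₁; proj₂)
open import Data.Sum using (_⊎_; inj₁; inj₂; [_,_]′)
open import Function using (_∘_)
open import Relation.Binary.Bundles using (DecTotalOrder)
open import Relation.Binary.Core using (Rel; _⇒_)
import Relation.Binary.Construct.Closure.Equivalence as Eq
open Eq using (EqClosure)
import Relation.Binary.Construct.Flip.EqAndOrd as Flip
import Relation.Binary.Construct.On as On
open import Relation.Binary.PropositionalEquality
open import Relation.Nullary using (¬_; yes; no; contradiction)
open import Relation.Nullary.Decidable using (_×-dec_)
open import Relation.Unary using (Pred; Decidable)

-- Comparing the numbers of components of two relations.

module _ {n : ℕ} {R R′ : Rel (Fin n) 0ℓ} {k k′ : ℕ}
         (c : Components R k) (c′ : Components R′ k′) where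
  private
    module C  = Components c
    module C′ = Components c′

    rep : Fin k → Fin n
    rep x = proj₁ (C.surjective x)

    label-rep : ∀ x → C.label (rep x) ≡ x
    label-rep x = proj₂ (C.surjective x)

    rep′ : Fin k′ → Fin n
    rep′ y = proj₁ (C′.surjective y)

    label-rep′ : ∀ y → C′.label (rep′ y) ≡ y
    label-rep′ y = proj₂ (C′.surjective y)

  components-antitone : R′ ⇒ EqClosure R → k ≤ k′
  components-antitone R′⇒R = injective⇒≤ {f = C′.label ∘ rep} λ {x} {y} eq →
    trans (sym (label-rep x))
          (trans (C.complete ((R′⇒R Eq.⋆) (C′.sound eq))) (label-rep y))

  -- Spending the extra value `zero` on the class of `a` leaves the other classes to be told apart
  -- by the `R′`-labels of their representatives. This works because `merge`, which renames the
  -- class of `a` to that of `b`, makes `C.label` constant on `R′`-classes and fixes every class but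
  -- that of `a`.
  components-addPair-≤ : ∀ a b → (∀ {u v} → R′ u v → R u v ⊎ (u ≡ a × v ≡ b)) →
                         k ≤ suc k′
  components-addPair-≤ a b split = injective⇒≤ {f = f} (λ {x} {y} → f-injective x y)
    where
    merge : Fin k → Fin k
    merge x with x ≟ C.label a
    ... | yes _ = C.label b
    ... | no _  = x

    merge-a : merge (C.label a) ≡ C.label b
    merge-a with C.label a ≟ C.label a
    ... | yes _ = refl
    ... | no ≢  = contradiction refl ≢

    merge-≢ : ∀ {x} → x ≢ C.label a → merge x ≡ x
    merge-≢ {x} ≢ with x ≟ C.label a
    ... | yes eq = contradiction eq ≢
    ... | no _   = refl

    merge-b : merge (C.label b) ≡ C.label b
    merge-b with C.label b ≟ C.label a
    ... | yes _ = refl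
    ... | no _  = refl

    merge-invariant : ∀ {u v} → EqClosure R′ u v →
                      merge (C.label u) ≡ merge (C.label v)
    merge-invariant = Eq.fold (On.isEquivalence (merge ∘ C.label) isEquivalence) λ r →
      [ cong merge ∘ C.complete ∘ Eq.return
      , (λ { (refl , refl) → trans merge-a (sym merge-b) }) ]′ (split r)

    f : Fin k → Fin (suc k′)
    f x with x ≟ C.label a
    ... | yes _ = zero
    ... | no _  = suc (C′.label (rep x))

    f-injective : ∀ x y → f x ≡ f y → x ≡ y
    f-injective x y eq with x ≟ C.label a | y ≟ C.label a
    ... | yes x≡ | yes y≡ = trans x≡ (sym y≡)
    ... | no x≢  | no y≢  = begin
      x                       ≡⟨ merge-≢ x≢ ⟨
      merge x                 ≡⟨ cong merge (label-rep x) ⟨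
      merge (C.label (rep x)) ≡⟨ merge-invariant (C′.sound (suc-injective eq)) ⟩
      merge (C.label (rep y)) ≡⟨ cong merge (label-rep y) ⟩
      merge y                 ≡⟨ merge-≢ y≢ ⟩
      y                       ∎
      where open ≡-Reasoning

  -- Representatives of the `R′`-classes have distinct `R`-labels. One more label is free, because
  -- the `R′`-class of `a` contains at least two `R`-classes.
  components-strict : ∀ {a b} → R ⇒ EqClosure R′ → EqClosure R′ a b →
                      ¬ EqClosure R a b → k′ < k
  components-strict {a} {b} R⇒R′ ab ¬ab =
    injective⇒≤ {f = f} λ { {x} {y} → f-injective x y }
    where
    y₀ : Fin k′
    y₀ = C′.label a

    -- The representative of `y₀` shares its `R`-class with at most one of `a` and `b`, so the other
    -- one serves.
    other : ∃[ u ] C′.label u ≡ y₀ × C.label u ≢ C.label (rep′ y₀)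
    other with C.label a ≟ C.label (rep′ y₀)
    ... | no ≢   = a , refl , ≢
    ... | yes eq = b , sym (C′.complete ab) , λ eq′ → ¬ab (C.sound (trans eq (sym eq′)))

    label′-resp : ∀ {u v} → C.label u ≡ C.label v → C′.label u ≡ C′.label v
    label′-resp eq = C′.complete ((R⇒R′ Eq.⋆) (C.sound eq))

    f : Fin (suc k′) → Fin k
    f zero    = C.label (proj₁ other)
    f (suc y) = C.label (rep′ y)

    f0≢fsuc : ∀ y → f zero ≢ f (suc y)
    f0≢fsuc y eq = proj₂ (proj₂ other) (trans eq (cong (C.label ∘ rep′) y≡y₀))
      where
      y≡y₀ : y ≡ y₀
      y≡y₀ = trans (sym (label-rep′ y))
                   (trans (sym (label′-resp eq)) (proj₁ (proj₂ other)))

    f-injective : ∀ x y → f x ≡ f y → x ≡ y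
    f-injective zero    zero    _  = refl
    f-injective zero    (suc y) eq = contradiction eq (f0≢fsuc y)
    f-injective (suc x) zero    eq = contradiction (sym eq) (f0≢fsuc x)
    f-injective (suc x) (suc y) eq =
      cong suc (trans (sym (label-rep′ x)) (trans (label′-resp eq) (label-rep′ y)))

-- The effect of added edges on the number of components.

module _ {n m : ℕ} (G : Graph n m) where
  open Graph G

  private
    comps : ∀ S → Components (Adjacent G S) (κ G S)
    comps S = proj₂ (components G S)

    adjacent-mono : ∀ {S T} → S ⊆ T → Adjacent G S ⇒ Adjacent G T
    adjacent-mono S⊆T (e , e∈S , eq) = e , S⊆T e∈S , eq

    adjacent-add : ∀ e {S u v} → Adjacent G (⁅ e ⁆ ∪ S) u v →
                   Adjacent G S u v ⊎ (u ≡ proj₁ (ends e) × v ≡ proj₂ (ends e))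
    adjacent-add e {S} (e′ , e′∈ , eq) with x∈p∪q⁻ ⁅ e ⁆ S e′∈
    ... | inj₂ e′∈S = inj₁ (e′ , e′∈S , eq)
    ... | inj₁ e′∈e with refl ← x∈⁅y⁆⇒x≡y e e′∈e =
      inj₂ (sym (cong proj₁ eq) , sym (cong proj₂ eq))

    adjacent-ends : ∀ e {S} → Adjacent G (⁅ e ⁆ ∪ S) (proj₁ (ends e)) (proj₂ (ends e))
    adjacent-ends e = e , x∈p∪q⁺ (inj₁ (x∈⁅x⁆ e)) , refl

  κ-antitone : ∀ {S T} → S ⊆ T → κ G T ≤ κ G S
  κ-antitone {S} {T} S⊆T =
    components-antitone (comps T) (comps S) (Eq.return ∘ adjacent-mono S⊆T)

  κ-connected : ∀ {S} → Connected G S → κ G S ≤ 1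
  κ-connected {S} (_ , joined) = injective⇒≤ {f = λ _ → zero {0}} λ {x} {y} _ →
    let open Components (comps S)
        (u , label-u) = surjective x
        (v , label-v) = surjective y
    in trans (sym label-u) (trans (complete (joined u v)) label-v)

  κ-add-≤ : ∀ e S → κ G S ≤ suc (κ G (⁅ e ⁆ ∪ S))
  κ-add-≤ e S = components-addPair-≤ (comps S) (comps (⁅ e ⁆ ∪ S)) _ _ (adjacent-add e)

  -- If the ends lay in different components, `e` would merge them and `components-strict` would
  -- give a drop. The conclusion is phrased with `Joined` because that property carries over to
  -- larger edge sets.
  κ-add-≮⇒joined : ∀ e S → ¬ (κ G (⁅ e ⁆ ∪ S) < κ G S) →
                   Joined G S (proj₁ (ends e)) (proj₂ (ends e))
  κ-add-≮⇒joined e S ≮ with Components.label (comps S) (proj₁ (ends e))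
                          ≟ Components.label (comps S) (proj₂ (ends e))
  ... | yes eq = Components.sound (comps S) eq
  ... | no ≢   = contradiction
    (components-strict (comps S) (comps (⁅ e ⁆ ∪ S))
      (Eq.return ∘ adjacent-mono (q⊆p∪q ⁅ e ⁆ S))
      (Eq.return (adjacent-ends e))
      (≢ ∘ Components.complete (comps S)))
    ≮

  κ-add-joined : ∀ e S → Joined G S (proj₁ (ends e)) (proj₂ (ends e)) →
                 κ G S ≤ κ G (⁅ e ⁆ ∪ S)
  κ-add-joined e S joined = components-antitone (comps S) (comps (⁅ e ⁆ ∪ S)) λ r →
    [ Eq.return , (λ { (refl , refl) → joined }) ]′ (adjacent-add e r)

  -- A list fixes an order of insertion, so that `κ` can be followed edge by edge; the head is
  -- inserted last.
  adjoin : List (Fin m) → Subset m → Subset m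
  adjoin es S = foldr (λ e T → ⁅ e ⁆ ∪ T) S es

  ⊆-adjoin : ∀ es {S} → S ⊆ adjoin es S
  ⊆-adjoin []       e∈S = e∈S
  ⊆-adjoin (e ∷ es) e∈S = q⊆p∪q ⁅ e ⁆ _ (⊆-adjoin es e∈S)

  ∈-adjoin : ∀ {e es S} → e List.∈ es → e ∈ adjoin es S
  ∈-adjoin {es = e ∷ es} (here refl) = x∈p∪q⁺ (inj₁ (x∈⁅x⁆ e))
  ∈-adjoin {es = e ∷ es} (there e∈)  = q⊆p∪q ⁅ e ⁆ _ (∈-adjoin e∈)

  lowers? : ∀ S → Decidable (λ e → κ G (⁅ e ⁆ ∪ S) < κ G S)
  lowers? S e = κ G (⁅ e ⁆ ∪ S) <? κ G S

  -- By induction on `es`: an edge that lowers `κ G S` is counted and pays for the at most one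
  -- component it removes from the larger graph; any other edge removes none there.
  κ-adjoin : ∀ es S → κ G S ≤ length (filter (lowers? S) es) + κ G (adjoin es S)
  κ-adjoin []       S = ℕ.≤-refl
  κ-adjoin (e ∷ es) S with κ G (⁅ e ⁆ ∪ S) <? κ G S
  ... | yes lowers = begin
    κ G S                                        ≤⟨ κ-adjoin es S ⟩
    l + κ G (adjoin es S)                        ≤⟨ ℕ.+-monoʳ-≤ l (κ-add-≤ e _) ⟩
    l + suc (κ G (adjoin (e ∷ es) S))            ≡⟨ ℕ.+-suc l _ ⟩
    suc l + κ G (adjoin (e ∷ es) S)              ≡⟨ cong (λ xs → length xs + κ G (adjoin (e ∷ es) S))
                                                         (filter-accept (lowers? S) {xs = es} lowers) ⟨
    length (filter (lowers? S) (e ∷ es)) + κ G (adjoin (e ∷ es) S) ∎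
    where
    open ℕ.≤-Reasoning
    l = length (filter (lowers? S) es)
  ... | no ¬lowers = begin
    κ G S                                        ≤⟨ κ-adjoin es S ⟩
    l + κ G (adjoin es S)                        ≤⟨ ℕ.+-monoʳ-≤ l (κ-add-joined e _ joined) ⟩
    l + κ G (adjoin (e ∷ es) S)                  ≡⟨ cong (λ xs → length xs + κ G (adjoin (e ∷ es) S))
                                                         (filter-reject (lowers? S) {xs = es} ¬lowers) ⟨
    length (filter (lowers? S) (e ∷ es)) + κ G (adjoin (e ∷ es) S) ∎
    where
    open ℕ.≤-Reasoning
    l = length (filter (lowers? S) es)
    -- The test is made at `S`, but the edge is added to `adjoin es S`; a path in `S` between its
    -- ends survives there.
    joined = Eq.map (adjacent-mono (⊆-adjoin es)) (κ-add-≮⇒joined e S ¬lowers)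

-- Double counting, and sums and lengths of lists.

module _ {a b r} {A : Set a} {B : Set b} {R : A → Pred B r}
         (R? : ∀ x → Decidable (R x)) where

  private
    sum-filter-∷ : ∀ xs y ys →
      sum (map (λ x → length (filter (R? x) (y ∷ ys))) xs) ≡
      length (filter (λ x → R? x y) xs) + sum (map (λ x → length (filter (R? x) ys)) xs)
    sum-filter-∷ []       y ys = refl
    sum-filter-∷ (x ∷ xs) y ys
      -- Both sides gain one exactly when `R x y` holds, so the induction hypothesis, with two
      -- summands exchanged, settles both cases.
      with R? x y
         | trans (cong (length (filter (R? x) ys) +_) (sum-filter-∷ xs y ys))
                 (x∙yz≈y∙xz (length (filter (R? x) ys))
                            (length (filter (λ x → R? x y) xs))
                            (sum (map (λ x → length (filter (R? x) ys)) xs)))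
    ... | no _  | eq = eq
    ... | yes _ | eq = cong suc eq

  double-count : ∀ xs ys →
    sum (map (λ x → length (filter (R? x) ys)) xs) ≡
    sum (map (λ y → length (filter (λ x → R? x y) xs)) ys)
  double-count xs []       = sum-zeros xs
    where
    sum-zeros : ∀ (xs : List A) → sum (map (λ _ → 0) xs) ≡ 0
    sum-zeros []       = refl
    sum-zeros (_ ∷ xs) = sum-zeros xs
  double-count xs (y ∷ ys) =
    trans (sum-filter-∷ xs y ys)
          (cong (length (filter (λ x → R? x y) xs) +_) (double-count xs ys))

sum-map-mono-≤ : ∀ {a} {A : Set a} {f g : A → ℕ} → (∀ x → f x ≤ g x) →
                 ∀ xs → sum (map f xs) ≤ sum (map g xs)
sum-map-mono-≤ f≤g []       = z≤n
sum-map-mono-≤ f≤g (x ∷ xs) = ℕ.+-mono-≤ (f≤g x) (sum-map-mono-≤ f≤g xs)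

-- When the head of `ys` is skipped, it can still be paired with the head of `xs`: that one occurs
-- later in `ys`, hence is no larger, and the rest of `xs` remains a sublist of the tail.
sum-sublist-≤-take : ∀ {xs ys} → xs Sublist.⊆ ys → AllPairs _≥_ ys →
                     sum xs ≤ sum (take (length xs) ys)
sum-sublist-≤-take                []         _            = z≤n
sum-sublist-≤-take                (refl ∷ p) (_ ∷ ≥s)     =
  ℕ.+-monoʳ-≤ _ (sum-sublist-≤-take p ≥s)
sum-sublist-≤-take {xs = []}      (_ ∷ʳ _)   _            = z≤n
sum-sublist-≤-take {xs = x ∷ xs}  (_ ∷ʳ p)   (y≥ ∷ ≥s)    =
  ℕ.+-mono-≤ (All.lookup y≥ (Sublist.lookup p (here refl)))
             (sum-sublist-≤-take (∷ˡ⁻ p) ≥s)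

-- Links list length to `∣_∣`. The function `f` is arbitrary because the induction on `W` passes to
-- `f ∘ suc`.
length-filter-tabulate-≤ : ∀ {a p} {A : Set a} {P : Pred A p} (P? : Decidable P)
  {m} (f : Fin m → A) (W : Subset m) → (∀ i → P (f i) → i ∈ W) →
  length (filter P? (tabulate f)) ≤ ∣ W ∣
length-filter-tabulate-≤ P? f Vec.[] _ = z≤n
length-filter-tabulate-≤ P? f (w Vec.∷ W) P⊆W
  with w | P? (f zero) | P⊆W zero
     | length-filter-tabulate-≤ P? (f ∘ suc) W (λ i → drop-there ∘ P⊆W (suc i))
... | inside  | yes _  | _   | ih = s≤s ih
... | inside  | no _   | _   | ih = ℕ.m≤n⇒m≤1+n ih
... | outside | no _   | _   | ih = ih
... | outside | yes p₀ | 0∈W | _  with () ← 0∈W p₀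

-- Color-connecting sets and the dip sequence.

module _ {n m ℓ : ℕ} (G : EdgeColoredGraph n m ℓ) where
  open EdgeColoredGraph G

  private
    open Data.List.Sort (Flip.decTotalOrder ℕ.≤-decTotalOrder) using (sort-↭; sort-↗)

    -- Ascending for the flipped order means descending for the usual one.
    dipSequence-≥ : AllPairs _≥_ (dipSequence G)
    dipSequence-≥ = Sorted⇒AllPairs
      (DecTotalOrder.totalOrder (Flip.decTotalOrder ℕ.≤-decTotalOrder))
      (sort-↗ (map (dip G) (allFin m)))

  totalExcess-≤-sum-dip : ∀ {W} → ColorConnecting G W →
    ∀ es → (∀ {e} → e ∈ W → e List.∈ es) → totalExcess G ≤ sum (map (dip G) es)
  totalExcess-≤-sum-dip {W} connecting es W⊆es = begin
    totalExcess G
      ≡⟨ cong sum (map-tabulate {n = ℓ} (λ i → i) (λ i → κ underlying (colorClass G i) ∸ 1)) ⟨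
    sum (map (λ i → κ underlying (colorClass G i) ∸ 1) (allFin ℓ))
      ≤⟨ sum-map-mono-≤ excess-≤ (allFin ℓ) ⟩
    sum (map (λ i → length (filter (lowers? underlying (colorClass G i)) es)) (allFin ℓ))
      -- After the exchange, the inner count at an edge `e` is `dip G e` by definition.
      ≡⟨ double-count (λ i → lowers? underlying (colorClass G i)) (allFin ℓ) es ⟩
    sum (map (dip G) es) ∎
    where
    open ℕ.≤-Reasoning

    excess-≤ : ∀ i → κ underlying (colorClass G i) ∸ 1 ≤
                     length (filter (lowers? underlying (colorClass G i)) es)
    -- Adjoining `es` gives a graph containing the connected one on `W ∪ S`; its single component is
    -- the 1 subtracted.
    excess-≤ i = ℕ.m≤n+o⇒m∸n≤o _ 1 (begin
      κ underlying S                                ≤⟨ κ-adjoin underlying es S ⟩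
      l + κ underlying (adjoin underlying es S)     ≤⟨ ℕ.+-monoʳ-≤ l
        (ℕ.≤-trans (κ-antitone underlying W∪S⊆adjoin)
                   (κ-connected underlying (connecting i))) ⟩
      l + 1                                         ≡⟨ ℕ.+-comm l 1 ⟩
      1 + l                                         ∎)
      where
      S = colorClass G i
      l = length (filter (lowers? underlying S) es)

      W∪S⊆adjoin : W ∪ S ⊆ adjoin underlying es S
      W∪S⊆adjoin e∈ = [ ∈-adjoin underlying ∘ W⊆es , ⊆-adjoin underlying es ]′
                        (x∈p∪q⁻ W S e∈)

  totalExcess-≤-take : ∀ {W} → ColorConnecting G W →
    ∃[ q ] q ≤ ∣ W ∣ × sum (take q (dipSequence G)) ≥ totalExcess G
  totalExcess-≤-take {W} connecting
    -- Sorting permutes only the numbers; `↭-map-inv` lifts this to an ordering `es` of the edges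
    -- whose dips form the dip sequence.
    with es , dips≡ , allFin↭es ← ↭-map-inv (dip G) (↭-sym (sort-↭ (map (dip G) (allFin m))))
    = length (map (dip G) ws) , length-ws , (begin
        totalExcess G         ≤⟨ totalExcess-≤-sum-dip connecting ws (λ {e} e∈W →
                                   ∈-filter⁺ (_∈? W) (∈-resp-↭ allFin↭es (∈-allFin e)) e∈W) ⟩
        sum (map (dip G) ws)  ≤⟨ sum-sublist-≤-take ws⊆dips dipSequence-≥ ⟩
        sum (take (length (map (dip G) ws)) (dipSequence G)) ∎)
    where
    open ℕ.≤-Reasoning

    -- Filtering `es` keeps the sorted order, which makes the dips of `W` a sublist of the dip
    -- sequence.
    ws : List (Fin m)
    ws = filter (_∈? W) es

    length-ws : length (map (dip G) ws) ≤ ∣ W ∣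
    length-ws = begin
      length (map (dip G) ws)               ≡⟨ length-map (dip G) ws ⟩
      -- Length ignores order, so the count can return to `allFin m`, which is aligned with the
      -- entries of `W`.
      length ws                             ≡⟨ ↭-length (filter-↭ (_∈? W) allFin↭es) ⟨
      length (filter (_∈? W) (allFin m))    ≤⟨ length-filter-tabulate-≤ (_∈? W) _ W (λ _ e∈W → e∈W) ⟩
      ∣ W ∣                                 ∎

    ws⊆dips : map (dip G) ws Sublist.⊆ dipSequence G
    ws⊆dips = subst (map (dip G) ws Sublist.⊆_) (sym dips≡)
                    (map⁺ (dip G) (filter-⊆ (_∈? W) es))

proposition5p6 : ∀ {n m ℓ : ℕ} (G : EdgeColoredGraph n m ℓ) →
    ∃[ p ] IsMinimum (λ q → q ≤ m × sum (take q (dipSequence G)) ≥ totalExcess G) p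
    × wld G ≥ p
proposition5p6 {m = m} G =
  let W , connecting , ∣W∣≡wld = proj₁ (proj₂ (minColorConnecting G))
      q , q≤∣W∣ , excess≤      = totalExcess-≤-take G connecting
      -- Since `∣ W ∣ ≤ m`, the value `q` lies in the permitted range, so the minimum is taken over
      -- a nonempty set.
      valid                    = ℕ.≤-trans q≤∣W∣ (∣p∣≤n W) , excess≤
      p , p-min                = minimum
        (λ q → (q ≤? m) ×-dec (totalExcess G ≤? sum (take q (dipSequence G)))) (q , valid)
  -- The chain is `p ≤ q ≤ ∣ W ∣ ≡ wld G`.
  in p , p-min , ℕ.≤-trans (proj₂ p-min q valid) (subst (q ≤_) ∣W∣≡wld q≤∣W∣)
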